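{- Let $\varphi\in\mathsf{FO}(\sim,\mathcal D)$, let $\vec x$ be a tuple of variables containing all free variables of $\varphi$, let $\mathcal A$ be a finite structure, and let $T$ be a finite team in $\mathcal A$ with domain $Y\supseteq\vec x$. Then $(\mathcal A,T)\vDash\varphi$ if and only if $\mathcal A\vDash\eta^{\vec x}_\varphi(\vec x\langle T\rangle)$.
   Context: Teams. A team $T$ in a $\tau$-structure $\mathcal A$ with domain $X$ (a set of variables) is a set of assignments $s\colon X\to \mathrm{dom}\,\mathcal A$. For a tuple $\vec t$ of terms with variables in $X$, $\vec t\langle s\rangle$ is its value under $s$ and $\vec t\langle T\rangle=\{\vec t\langle s\rangle\mid s\in T\}$. For $f\colon T\to\mathfrak P(\mathrm{dom}\,\mathcal A)\setminus\{\emptyset\}$ let $T^x_f=\{s^x_a\mid s\in T, a\in f(s)\}$, where $s^x_a$ maps $x$ to $a$ and agrees with $s$ on the other variables; $T^x_A$ is the case $f(s)=A$ constant. A tuple $\vec x$ is identified with its underlying set where convenient. Dependencies. A $k$-ary dependency is a first-order sentence $\delta$ (equality allowed) over a vocabulary $\{P\}$ with $P$ a $k$-ary predicate. $\mathcal D=\{\delta_1,\delta_2,\ldots\}$ is a (possibly infinite) set of dependencies; for $k$-ary $\delta_i\in\mathcal D$ and a $k$-tuple $\vec t$ of $\tau$-terms there is a dependency atom $A_i\vec t$. Logic. $\mathsf{FO}(\sim,\mathcal D)$ (over $\tau$) has the formulas $\varphi ::= \alpha \mid A_i\vec t\mid {\sim}\varphi \mid \varphi\wedge\varphi \mid \varphi\vee\varphi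 \mid \exists x\,\varphi \mid \forall x\,\varphi$ with $\alpha$ an ordinary first-order $\tau$-formula. For a team $T$ whose domain contains the free variables of $\varphi$: if $\varphi\in\mathsf{FO}$, $(\mathcal A,T)\vDash\varphi$ iff $(\mathcal A,s)\vDash\varphi$ (Tarski) for all $s\in T$; otherwise $(\mathcal A,T)\vDash A_i\vec t$ iff $\delta_i$ holds in the structure with domain $\mathrm{dom}\,\mathcal A$ and $P$ interpreted as $\vec t\langle T\rangle$; $(\mathcal A,T)\vDash{\sim}\psi$ iff $(\mathcal A,T)\nvDash\psi$; $\wedge$ is conjunction; $(\mathcal A,T)\vDash\psi\vee\theta$ iff there are $S,U\subseteq T$ with $T=S\cup U$, $(\mathcal A,S)\vDash\psi$, $(\mathcal A,U)\vDash\theta$; $(\mathcal A,T)\vDash\exists x\,\psi$ iff $(\mathcal A,T^x_f)\vDash\psi$ for some $f\colon T\to\mathfrak P(\mathrm{dom}\,\mathcal A)\setminus\{\emptyset\}$; $(\mathcal A,T)\vDash\forall x\,\psi$ iff $(\mathcal A,T^x_{\mathrm{dom}\,\mathcal A})\vDash\psi$. Translation to second-order logic (with equality). For $\vec x=(x_1,\ldots,x_n)$, a variable $y$, let $\vec x;y$ be $\vec x$ if $y\in\{x_1,\ldots,x_n\}$ and $(x_1,\ldots,x_n,y)$ otherwise. For $\varphi\in\mathsf{FO}(\sim,\mathcal D)$ with free variables in $\vec x$ and an $n$-ary predicate variable $R$, the second-order formula $\eta^{\vec x}_\varphi(R)$ is defined recursively ($S,U$ are fresh predicate variables of the appropriate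 arity): - $\varphi$ first-order: $\forall\vec x\,(R\vec x\to\varphi)$; - $\varphi=A_i\vec t$ with $\delta_i$ $k$-ary: $\exists S\,\big[\forall\vec z\,(S\vec z\leftrightarrow\exists\vec x\,(R\vec x\wedge\vec t=\vec z))\wedge\delta_i(S)\big]$, where $\vec z=(z_1,\ldots,z_k)$ are pairwise distinct variables not in $\vec x$ and $\delta_i(S)$ is $\delta_i$ with $P$ replaced by $S$; - $\varphi={\sim}\psi$: $\neg\eta^{\vec x}_\psi(R)$; - $\varphi=\psi\wedge\theta$: $\eta^{\vec x}_\psi(R)\wedge\eta^{\vec x}_\theta(R)$; - $\varphi=\psi\vee\theta$: $\exists S\,\exists U\,\big[\forall\vec x\,(R\vec x\leftrightarrow(S\vec x\vee U\vec x))\wedge\eta^{\vec x}_\psi(S)\wedge\eta^{\vec x}_\theta(U)\big]$; - $\varphi=\exists y\,\psi$: $\exists S\,\big[\forall\vec x\,((\exists y\,R\vec x)\leftrightarrow(\exists y\,S\,\vec x;y))\wedge\eta^{\vec x;y}_\psi(S)\big]$; - $\varphi=\forall y\,\psi$: $\exists S\,\big[\forall\vec x\,((\exists y\,R\vec x)\leftrightarrow(\exists y\,S\,\vec x;y))\wedge\eta^{\vec x;y}_\psi(S)\wedge\forall\vec x\,(R\vec x\to\forall y\,S\,\vec x;y)\big]$. The first clause takes precedence when $\varphi$ is first-order. $\mathcal A\vDash\eta^{\vec x}_\varphi(Q)$ means that $\eta^{\vec x}_\varphi(R)$ holds in $\mathcal A$ with $R$ interpreted as $Q$. -}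

module Defs where

open import Data.Bool using (if_then_else_)
open import Data.Empty using (⊥; ⊥-elim)
open import Data.Fin using (Fin; toℕ)
open import Data.List using (List; []; _∷_; _∷ʳ_; foldr; length)
open import Data.List.Membership.DecPropositional using () renaming (_∈?_ to mem?)
import Data.List.Membership.Propositional as L
open import Data.List.Relation.Unary.All using (All; _∷_; lookup)
open import Data.List.Relation.Unary.Any using (Any; here; there)
open import Data.Maybe using (Maybe; just; nothing; zipWith) renaming (map to mapᵐ)
open import Data.Nat using (ℕ; suc; _+_; _⊔_; _≟_)
open import Data.Product using (∃; Σ; _×_; _,_)
open import Data.Sum using (_⊎_; inj₁; inj₂)
open import Data.Unit using (⊤)
open import Data.Vec using (Vec; []; _∷_; fromList; map; tabulate; toList)
open import Function using (_↔_; _⇔_)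
open import Level using (0ℓ; Lift)
open import Relation.Binary using (_Respects_)
open import Relation.Binary.PropositionalEquality using (_≡_; refl; sym; trans)
open import Relation.Nullary using (¬_; yes; no; does)
open import Relation.Unary using (Pred; _∈_; _⊆_; _∪_; _∖_; ∅; U; ｛_｝; Satisfiable)

------------------------------------------------------------------------
-- First-order logic

Var : Set
Var = ℕ

record Vocabulary : Set₁ where
  field
    Fun : Set
    Rel : Set
    arF : Fun → ℕ
    arR : Rel → ℕ

open Vocabulary public

data Term (τ : Vocabulary) : Set where
  var : Var → Term τ
  fun : (f : Fun τ) → Vec (Term τ) (arF τ f) → Term τ

infix  8 _≐′_
infixr 6 _∧′_
infixr 5 _∨′_
infixr 4 _⇒′_

data FO (τ : Vocabulary) : Set where
  ⊤′             : FO τ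
  _≐′_           : Term τ → Term τ → FO τ
  rel            : (r : Rel τ) → Vec (Term τ) (arR τ r) → FO τ
  ¬′_            : FO τ → FO τ
  _∧′_ _∨′_ _⇒′_ : FO τ → FO τ → FO τ
  ∃′ ∀′          : Var → FO τ → FO τ

module _ {τ : Vocabulary} where

  mutual
    FVᵗ : Term τ → Pred Var 0ℓ
    FVᵗ (var x)    = ｛ x ｝
    FVᵗ (fun _ ts) = FVᵗˢ ts

    FVᵗˢ : ∀ {k} → Vec (Term τ) k → Pred Var 0ℓ
    FVᵗˢ []       = ∅
    FVᵗˢ (t ∷ ts) = FVᵗ t ∪ FVᵗˢ ts

  FVᶠ : FO τ → Pred Var 0ℓ
  FVᶠ ⊤′         = ∅
  FVᶠ (t ≐′ u)   = FVᵗ t ∪ FVᵗ u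
  FVᶠ (rel _ ts) = FVᵗˢ ts
  FVᶠ (¬′ α)     = FVᶠ α
  FVᶠ (α ∧′ β)   = FVᶠ α ∪ FVᶠ β
  FVᶠ (α ∨′ β)   = FVᶠ α ∪ FVᶠ β
  FVᶠ (α ⇒′ β)   = FVᶠ α ∪ FVᶠ β
  FVᶠ (∃′ x α)   = FVᶠ α ∖ ｛ x ｝
  FVᶠ (∀′ x α)   = FVᶠ α ∖ ｛ x ｝

-- Domains are nonempty, as usual in first-order logic; the translation below
-- is incorrect over the empty domain.
record Structure (τ : Vocabulary) : Set₁ where
  field
    dom   : Set
    point : dom
    funᴵ  : (f : Fun τ) → Vec dom (arF τ f) → dom
    relᴵ  : (r : Rel τ) → Pred (Vec dom (arR τ r)) 0ℓ

open Structure public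

FiniteStructure : ∀ {τ} → Structure τ → Set
FiniteStructure 𝔄 = ∃ λ n → dom 𝔄 ↔ Fin n

-- Assignments X → A.  The membership proof is irrelevant, so that the value
-- depends on the variable only.
Asg : Set → Pred Var 0ℓ → Set
Asg A X = (v : Var) → .(v ∈ X) → A

infix 4 _≈_
_≈_ : ∀ {A X} → Asg A X → Asg A X → Set
_≈_ {X = X} s s′ = ∀ v (p : v ∈ X) → s v p ≡ s′ v p

_[_↦_] : ∀ {A X} → Asg A X → (x : Var) → A → Asg A (X ∪ ｛ x ｝)
_[_↦_] {X = X} s x a v p with v ≟ x
... | yes _  = a
... | no v≢x = s v (strip p)
  where
  strip : v ∈ (X ∪ ｛ x ｝) → v ∈ X
  strip (inj₁ q) = q
  strip (inj₂ e) = ⊥-elim (v≢x (sym e))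

∖⊆⇒⊆∪ : ∀ {P X : Pred Var 0ℓ} x → P ∖ ｛ x ｝ ⊆ X → P ⊆ X ∪ ｛ x ｝
∖⊆⇒⊆∪ x h {v} q with x ≟ v
... | yes e = inj₂ e
... | no ¬e = inj₁ (h (q , ¬e))

module _ {τ : Vocabulary} (𝔄 : Structure τ) {X : Pred Var 0ℓ} (s : Asg (dom 𝔄) X) where

  mutual
    ⟦_⟧ᵗ : (t : Term τ) → .(FVᵗ t ⊆ X) → dom 𝔄
    ⟦ var x ⟧ᵗ    p = s x (p refl)
    ⟦ fun f ts ⟧ᵗ p = funᴵ 𝔄 f (⟦ ts ⟧ᵗˢ p)

    ⟦_⟧ᵗˢ : ∀ {k} (ts : Vec (Term τ) k) → .(FVᵗˢ ts ⊆ X) → Vec (dom 𝔄) k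
    ⟦ [] ⟧ᵗˢ     p = []
    ⟦ t ∷ ts ⟧ᵗˢ p = ⟦ t ⟧ᵗ (λ q → p (inj₁ q)) ∷ ⟦ ts ⟧ᵗˢ (λ q → p (inj₂ q))

Tarski : ∀ {τ} (𝔄 : Structure τ) {X} → Asg (dom 𝔄) X → (α : FO τ) → .(FVᶠ α ⊆ X) → Set
Tarski 𝔄 s ⊤′         p = ⊤
Tarski 𝔄 s (t ≐′ u)   p = ⟦_⟧ᵗ 𝔄 s t (λ q → p (inj₁ q)) ≡ ⟦_⟧ᵗ 𝔄 s u (λ q → p (inj₂ q))
Tarski 𝔄 s (rel r ts) p = relᴵ 𝔄 r (⟦_⟧ᵗˢ 𝔄 s ts p)
Tarski 𝔄 s (¬′ α)     p = ¬ Tarski 𝔄 s α p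
Tarski 𝔄 s (α ∧′ β)   p = Tarski 𝔄 s α (λ q → p (inj₁ q)) × Tarski 𝔄 s β (λ q → p (inj₂ q))
Tarski 𝔄 s (α ∨′ β)   p = Tarski 𝔄 s α (λ q → p (inj₁ q)) ⊎ Tarski 𝔄 s β (λ q → p (inj₂ q))
Tarski 𝔄 s (α ⇒′ β)   p = Tarski 𝔄 s α (λ q → p (inj₁ q)) → Tarski 𝔄 s β (λ q → p (inj₂ q))
Tarski 𝔄 s (∃′ x α)   p = ∃ λ a → Tarski 𝔄 (s [ x ↦ a ]) α (∖⊆⇒⊆∪ x p)
Tarski 𝔄 s (∀′ x α)   p = ∀ a → Tarski 𝔄 (s [ x ↦ a ]) α (∖⊆⇒⊆∪ x p)

------------------------------------------------------------------------
-- Dependencies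

⟨P⟩ : ℕ → Vocabulary
⟨P⟩ k = record { Fun = ⊥ ; Rel = ⊤ ; arF = λ () ; arR = λ _ → k }

record Dependency : Set where
  field
    arity    : ℕ
    δ        : FO (⟨P⟩ arity)
    sentence : FVᶠ δ ⊆ ∅

open Dependency public

HoldsFor : (d : Dependency) {A : Set} → A → Pred (Vec A (arity d)) 0ℓ → Set
HoldsFor d {A} a Q = Tarski 𝔓 {X = ∅} (λ _ ()) (δ d) (sentence d)
  where
  𝔓 : Structure (⟨P⟩ (arity d))
  𝔓 = record { dom = A ; point = a ; funᴵ = λ () ; relᴵ = λ _ → Q }

------------------------------------------------------------------------
-- Teams

record Team (A : Set) (X : Pred Var 0ℓ) : Set₁ where
  field
    mem  : Pred (Asg A X) 0ℓ
    resp : mem Respects _≈_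

open Team public

infix 4 _∈ᵀ_ _⊆ᵀ_ _≡_∪ᵀ_
_∈ᵀ_ : ∀ {A X} → Asg A X → Team A X → Set
s ∈ᵀ T = s ∈ mem T

_⊆ᵀ_ : ∀ {A X} → Team A X → Team A X → Set
S ⊆ᵀ T = mem S ⊆ mem T

_≡_∪ᵀ_ : ∀ {A X} → Team A X → Team A X → Team A X → Set
T ≡ S ∪ᵀ V = ∀ s → s ∈ᵀ T ⇔ (s ∈ᵀ S ⊎ s ∈ᵀ V)

FiniteTeam : ∀ {A X} → Team A X → Set
FiniteTeam {A} {X} T = Σ (List (Asg A X)) λ l → ∀ s → s ∈ᵀ T ⇔ Any (s ≈_) l

-- Functions T → 𝔓(A) ∖ {∅}; values outside T are immaterial.
record Supplement {A X} (T : Team A X) : Set₁ where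
  field
    choice   : Asg A X → Pred A 0ℓ
    respects : ∀ {s s′} → s ∈ᵀ T → s ≈ s′ → choice s ⊆ choice s′
    nonempty : ∀ {s} → s ∈ᵀ T → Satisfiable (choice s)

open Supplement public

_⟨_≔_⟩ : ∀ {A X} (T : Team A X) (x : Var) → Supplement T → Team A (X ∪ ｛ x ｝)
mem  (T ⟨ x ≔ f ⟩) s′ = ∃ λ s → s ∈ᵀ T × ∃ λ a → a ∈ choice f s × s′ ≈ s [ x ↦ a ]
resp (T ⟨ x ≔ f ⟩) s′≈s″ (s , s∈T , a , a∈f , e) =
  s , s∈T , a , a∈f , λ v p → trans (sym (s′≈s″ v p)) (e v p)

full : ∀ {A X} (T : Team A X) → A → Supplement T
full T a = record { choice = λ _ → U ; respects = λ _ _ q → q ; nonempty = λ _ → a , _ }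

values : ∀ {τ} (𝔄 : Structure τ) {X k} (ts : Vec (Term τ) k) → .(FVᵗˢ ts ⊆ X) →
         Team (dom 𝔄) X → Pred (Vec (dom 𝔄) k) 0ℓ
values 𝔄 ts p T a⃗ = ∃ λ s → s ∈ᵀ T × ⟦_⟧ᵗˢ 𝔄 s ts p ≡ a⃗

vars : ∀ {τ} (x⃗ : List Var) → Vec (Term τ) (length x⃗)
vars x⃗ = map var (fromList x⃗)

FV-vars : ∀ {τ} x⃗ → FVᵗˢ (vars {τ} x⃗) ⊆ (L._∈ x⃗)
FV-vars (x ∷ x⃗) (inj₁ e) = here (sym e)
FV-vars (x ∷ x⃗) (inj₂ q) = there (FV-vars x⃗ q)

tupleValues : ∀ {τ} (𝔄 : Structure τ) {X} (x⃗ : List Var) → .((L._∈ x⃗) ⊆ X) →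
              Team (dom 𝔄) X → Pred (Vec (dom 𝔄) (length x⃗)) 0ℓ
tupleValues 𝔄 x⃗ p = values 𝔄 (vars x⃗) (λ q → p (FV-vars x⃗ q))

------------------------------------------------------------------------
-- FO(∼,𝒟)

infix  7 ∼_
infixr 6 _∧ᵗ_
infixr 5 _∨ᵗ_

data TL (τ : Vocabulary) {I : Set} (𝒟 : I → Dependency) : Set where
  fo        : FO τ → TL τ 𝒟
  dep       : (i : I) → Vec (Term τ) (arity (𝒟 i)) → TL τ 𝒟
  ∼_        : TL τ 𝒟 → TL τ 𝒟
  _∧ᵗ_ _∨ᵗ_ : TL τ 𝒟 → TL τ 𝒟 → TL τ 𝒟
  ∃ᵗ ∀ᵗ     : Var → TL τ 𝒟 → TL τ 𝒟

module _ {τ : Vocabulary} {I : Set} {𝒟 : I → Dependency} where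

  FV : TL τ 𝒟 → Pred Var 0ℓ
  FV (fo α)     = FVᶠ α
  FV (dep _ ts) = FVᵗˢ ts
  FV (∼ φ)      = FV φ
  FV (φ ∧ᵗ ψ)   = FV φ ∪ FV ψ
  FV (φ ∨ᵗ ψ)   = FV φ ∪ FV ψ
  FV (∃ᵗ x φ)   = FV φ ∖ ｛ x ｝
  FV (∀ᵗ x φ)   = FV φ ∖ ｛ x ｝

  -- Decides whether a formula is first-order.  For instance fo α ∧ᵗ fo β and
  -- fo (α ∧′ β) are the same formula α ∧ β of the logic, and both are
  -- recognised as first-order here.
  toFO : TL τ 𝒟 → Maybe (FO τ)
  toFO (fo α)    = just α
  toFO (dep _ _) = nothing
  toFO (∼ _)     = nothing
  toFO (φ ∧ᵗ ψ)  = zipWith _∧′_ (toFO φ) (toFO ψ)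
  toFO (φ ∨ᵗ ψ)  = zipWith _∨′_ (toFO φ) (toFO ψ)
  toFO (∃ᵗ x φ)  = mapᵐ (∃′ x) (toFO φ)
  toFO (∀ᵗ x φ)  = mapᵐ (∀′ x) (toFO φ)

  FV-toFO : ∀ φ {α} → toFO φ ≡ just α → FVᶠ α ⊆ FV φ
  FV-toFO (fo _) refl q = q
  FV-toFO (φ ∧ᵗ ψ) e q with toFO φ in eφ | toFO ψ in eψ
  FV-toFO (φ ∧ᵗ ψ) refl (inj₁ q) | just _ | just _ = inj₁ (FV-toFO φ eφ q)
  FV-toFO (φ ∧ᵗ ψ) refl (inj₂ q) | just _ | just _ = inj₂ (FV-toFO ψ eψ q)
  FV-toFO (φ ∨ᵗ ψ) e q with toFO φ in eφ | toFO ψ in eψ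
  FV-toFO (φ ∨ᵗ ψ) refl (inj₁ q) | just _ | just _ = inj₁ (FV-toFO φ eφ q)
  FV-toFO (φ ∨ᵗ ψ) refl (inj₂ q) | just _ | just _ = inj₂ (FV-toFO ψ eψ q)
  FV-toFO (∃ᵗ x φ) e q with toFO φ in eφ
  FV-toFO (∃ᵗ x φ) refl (q , ¬e) | just _ = FV-toFO φ eφ q , ¬e
  FV-toFO (∀ᵗ x φ) e q with toFO φ in eφ
  FV-toFO (∀ᵗ x φ) refl (q , ¬e) | just _ = FV-toFO φ eφ q , ¬e

  module _ (𝔄 : Structure τ) where

    Flat : ∀ {X} → Team (dom 𝔄) X → (α : FO τ) → .(FVᶠ α ⊆ X) → Set₁
    Flat T α p = Lift _ (∀ s → s ∈ᵀ T → Tarski 𝔄 s α p)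

    mutual
      Sat : ∀ {X} → Team (dom 𝔄) X → (φ : TL τ 𝒟) → .(FV φ ⊆ X) → Set₁
      Sat T φ p with toFO φ in e
      ... | just α  = Flat T α (λ q → p (FV-toFO φ e q))
      ... | nothing = SatClause T φ p

      -- Used for formulas that are not first-order; hence the case fo α is
      -- never reached from Sat.
      SatClause : ∀ {X} → Team (dom 𝔄) X → (φ : TL τ 𝒟) → .(FV φ ⊆ X) → Set₁
      SatClause T (fo α) p = Flat T α p
      SatClause T (dep i ts) p = Lift _ (HoldsFor (𝒟 i) (point 𝔄) (values 𝔄 ts p T))
      SatClause T (∼ φ) p = ¬ Sat T φ p
      SatClause T (φ ∧ᵗ ψ) p = Sat T φ (λ q → p (inj₁ q)) × Sat T ψ (λ q → p (inj₂ q))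
      SatClause {X} T (φ ∨ᵗ ψ) p =
        Σ (Team (dom 𝔄) X) λ S → Σ (Team (dom 𝔄) X) λ V →
          S ⊆ᵀ T × V ⊆ᵀ T × T ≡ S ∪ᵀ V ×
          Sat S φ (λ q → p (inj₁ q)) × Sat V ψ (λ q → p (inj₂ q))
      SatClause T (∃ᵗ x φ) p = Σ (Supplement T) λ f → Sat (T ⟨ x ≔ f ⟩) φ (∖⊆⇒⊆∪ x p)
      SatClause T (∀ᵗ x φ) p = Sat (T ⟨ x ≔ full T (point 𝔄) ⟩) φ (∖⊆⇒⊆∪ x p)

------------------------------------------------------------------------
-- Second-order logic

-- First-order variables are named.  Predicate variables are de Bruijn indices
-- into the list Γ of the arities of those in scope, so that a quantified
-- predicate variable is automatically fresh.

infix  8 _≐²_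
infixr 6 _∧²_
infixr 5 _∨²_
infixr 4 _⇒²_ _⇔²_

data SO (τ : Vocabulary) (Γ : List ℕ) : Set where
  ⊤²             : SO τ Γ
  _≐²_           : Term τ → Term τ → SO τ Γ
  rel            : (r : Rel τ) → Vec (Term τ) (arR τ r) → SO τ Γ
  pred           : ∀ {k} → k L.∈ Γ → Vec (Term τ) k → SO τ Γ
  ¬²_            : SO τ Γ → SO τ Γ
  _∧²_ _∨²_ _⇒²_ : SO τ Γ → SO τ Γ → SO τ Γ
  ∃¹ ∀¹          : Var → SO τ Γ → SO τ Γ
  ∃² ∀²          : (k : ℕ) → SO τ (k ∷ Γ) → SO τ Γ

_⇔²_ : ∀ {τ Γ} → SO τ Γ → SO τ Γ → SO τ Γ
α ⇔² β = (α ⇒² β) ∧² (β ⇒² α)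

∃⃗ ∀⃗ : ∀ {τ Γ} → List Var → SO τ Γ → SO τ Γ
∃⃗ x⃗ α = foldr ∃¹ α x⃗
∀⃗ x⃗ α = foldr ∀¹ α x⃗

_≐⃗_ : ∀ {τ Γ k} → Vec (Term τ) k → Vec (Term τ) k → SO τ Γ
[]       ≐⃗ []       = ⊤²
(t ∷ ts) ≐⃗ (u ∷ us) = (t ≐² u) ∧² (ts ≐⃗ us)

embed : ∀ {τ Γ} → FO τ → SO τ Γ
embed ⊤′         = ⊤²
embed (t ≐′ u)   = t ≐² u
embed (rel r ts) = rel r ts
embed (¬′ α)     = ¬² embed α
embed (α ∧′ β)   = embed α ∧² embed β
embed (α ∨′ β)   = embed α ∨² embed β
embed (α ⇒′ β)   = embed α ⇒² embed β
embed (∃′ x α)   = ∃¹ x (embed α)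
embed (∀′ x α)   = ∀¹ x (embed α)

-- Over ⟨P⟩ k every term is a variable.
termP : ∀ {τ k} → Term (⟨P⟩ k) → Term τ
termP (var x) = var x

-- The formula α(S), i.e. α with P replaced by S.
replaceP : ∀ {τ Γ k} → k L.∈ Γ → FO (⟨P⟩ k) → SO τ Γ
replaceP S ⊤′         = ⊤²
replaceP S (t ≐′ u)   = termP t ≐² termP u
replaceP S (rel _ ts) = pred S (map termP ts)
replaceP S (¬′ α)     = ¬² replaceP S α
replaceP S (α ∧′ β)   = replaceP S α ∧² replaceP S β
replaceP S (α ∨′ β)   = replaceP S α ∨² replaceP S β
replaceP S (α ⇒′ β)   = replaceP S α ⇒² replaceP S β
replaceP S (∃′ x α)   = ∃¹ x (replaceP S α)
replaceP S (∀′ x α)   = ∀¹ x (replaceP S α)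

module _ {τ : Vocabulary} (𝔄 : Structure τ) where

  mutual
    eval : (Var → dom 𝔄) → Term τ → dom 𝔄
    eval s (var x)    = s x
    eval s (fun f ts) = funᴵ 𝔄 f (evals s ts)

    evals : ∀ {k} → (Var → dom 𝔄) → Vec (Term τ) k → Vec (dom 𝔄) k
    evals s []       = []
    evals s (t ∷ ts) = eval s t ∷ evals s ts

  update : (Var → dom 𝔄) → Var → dom 𝔄 → Var → dom 𝔄
  update s x a v = if does (v ≟ x) then a else s v

  PredEnv : List ℕ → Set₁
  PredEnv = All (λ k → Pred (Vec (dom 𝔄) k) 0ℓ)

  SatSO : ∀ {Γ} → PredEnv Γ → (Var → dom 𝔄) → SO τ Γ → Set₁
  SatSO ρ s ⊤²          = Lift _ ⊤
  SatSO ρ s (t ≐² u)    = Lift _ (eval s t ≡ eval s u)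
  SatSO ρ s (rel r ts)  = Lift _ (relᴵ 𝔄 r (evals s ts))
  SatSO ρ s (pred R ts) = Lift _ (lookup ρ R (evals s ts))
  SatSO ρ s (¬² α)      = ¬ SatSO ρ s α
  SatSO ρ s (α ∧² β)    = SatSO ρ s α × SatSO ρ s β
  SatSO ρ s (α ∨² β)    = SatSO ρ s α ⊎ SatSO ρ s β
  SatSO ρ s (α ⇒² β)    = SatSO ρ s α → SatSO ρ s β
  SatSO ρ s (∃¹ x α)    = ∃ λ a → SatSO ρ (update s x a) α
  SatSO ρ s (∀¹ x α)    = ∀ a → SatSO ρ (update s x a) α
  SatSO ρ s (∃² k α)    = Σ (Pred (Vec (dom 𝔄) k) 0ℓ) λ Q → SatSO (Q ∷ ρ) s α
  SatSO ρ s (∀² k α)    = (Q : Pred (Vec (dom 𝔄) k) 0ℓ) → SatSO (Q ∷ ρ) s α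

  -- Truth of a formula without free first-order variables, with the free
  -- predicate variables interpreted by ρ.
  Models : ∀ {Γ} → PredEnv Γ → SO τ Γ → Set₁
  Models ρ α = ∀ s → SatSO ρ s α

------------------------------------------------------------------------
-- The translation

infixl 5 _﹔_
_﹔_ : List Var → Var → List Var
x⃗ ﹔ y = if does (mem? _≟_ y x⃗) then x⃗ else x⃗ ∷ʳ y

-- k pairwise distinct variables not in x⃗: those following the largest
-- element of x⃗.
freshVars : List Var → (k : ℕ) → Vec Var k
freshVars x⃗ k = tabulate λ i → suc (foldr _⊔_ 0 x⃗) + toℕ i

module _ {τ : Vocabulary} {I : Set} {𝒟 : I → Dependency} where

  mutual
    η : ∀ {Γ} (x⃗ : List Var) → TL τ 𝒟 → length x⃗ L.∈ Γ → SO τ Γ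
    η x⃗ φ R with toFO φ
    ... | just α  = ∀⃗ x⃗ (pred R (vars x⃗) ⇒² embed α)
    ... | nothing = ηClause x⃗ φ R

    -- Used for formulas that are not first-order; hence the case fo α is
    -- never reached from η.
    ηClause : ∀ {Γ} (x⃗ : List Var) → TL τ 𝒟 → length x⃗ L.∈ Γ → SO τ Γ
    ηClause x⃗ (fo α) R = ∀⃗ x⃗ (pred R (vars x⃗) ⇒² embed α)
    ηClause {Γ} x⃗ (dep i ts) R = ∃² k
      (∀⃗ (toList z⃗)
         (pred S (map var z⃗) ⇔² ∃⃗ x⃗ (pred (there R) (vars x⃗) ∧² (ts ≐⃗ map var z⃗)))
       ∧² replaceP S (δ (𝒟 i)))
      where
      k  = arity (𝒟 i)
      z⃗ = freshVars x⃗ k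
      S : k L.∈ (k ∷ Γ)
      S = here refl
    ηClause x⃗ (∼ φ) R = ¬² η x⃗ φ R
    ηClause x⃗ (φ ∧ᵗ ψ) R = η x⃗ φ R ∧² η x⃗ ψ R
    ηClause {Γ} x⃗ (φ ∨ᵗ ψ) R = ∃² n (∃² n
      (∀⃗ x⃗ (pred (there (there R)) (vars x⃗) ⇔² (pred S (vars x⃗) ∨² pred V (vars x⃗)))
       ∧² η x⃗ φ S ∧² η x⃗ ψ V))
      where
      n = length x⃗
      S V : n L.∈ (n ∷ n ∷ Γ)
      S = there (here refl)
      V = here refl
    ηClause {Γ} x⃗ (∃ᵗ y φ) R = ∃² n
      (∀⃗ x⃗ (∃¹ y (pred (there R) (vars x⃗)) ⇔² ∃¹ y (pred S (vars (x⃗ ﹔ y))))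
       ∧² η (x⃗ ﹔ y) φ S)
      where
      n = length (x⃗ ﹔ y)
      S : n L.∈ (n ∷ Γ)
      S = here refl
    ηClause {Γ} x⃗ (∀ᵗ y φ) R = ∃² n
      (∀⃗ x⃗ (∃¹ y (pred (there R) (vars x⃗)) ⇔² ∃¹ y (pred S (vars (x⃗ ﹔ y))))
       ∧² η (x⃗ ﹔ y) φ S
       ∧² ∀⃗ x⃗ (pred (there R) (vars x⃗) ⇒² ∀¹ y (pred S (vars (x⃗ ﹔ y)))))
      where
      n = length (x⃗ ﹔ y)
      S : n L.∈ (n ∷ Γ)
      S = here refl

{-# OPTIONS --safe #-}
module Submission where

-- Induction on φ, for every predicate Q that describes T, i.e. contains the
-- value of x⃗ under w iff some t ∈ T agrees with w on x⃗.  The only steps that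
-- are not bookkeeping recover a team from a predicate.  For ψ ∨ θ, a splitting
-- Q = S ∪ U of tuples is pulled back to T along t ↦ t(x⃗).  For ∃y ψ, a
-- predicate S with ∃y Q x⃗ ↔ ∃y S(x⃗;y) describes T^y_f for
-- f(t) = {a ∣ t^y_a(x⃗;y) ∈ S}; if y occurs in x⃗, both sides of the
-- equivalence forget the old value of y, just as T^y_f does.  For ∀y ψ the
-- additional conjunct forces f(t) to be the whole domain.

open import Data.Bool using (if_then_else_)
open import Data.Empty using (⊥-elim)
open import Data.Fin using (Fin; toℕ)
open import Data.Fin.Properties using (any?; toℕ-injective)
open import Data.List using (List; []; _∷_; foldr; length)
open import Data.List.Membership.DecPropositional using () renaming (_∈?_ to mem?)
open import Data.List.Membership.Propositional using () renaming (_∈_ to _∈ˡ_; _∉_ to _∉ˡ_)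
open import Data.List.Membership.Propositional.Properties using (∈-++⁺ˡ; ∈-++⁺ʳ; ∈-++⁻)
open import Data.List.Relation.Unary.All using ([]; _∷_; lookup)
open import Data.List.Relation.Unary.Any using (here; there)
open import Data.Maybe using (Maybe; just; nothing)
open import Data.Nat using (suc; _+_; _⊔_; _≤_; _≟_)
open import Data.Nat.Properties using (m≤m⊔n; m≤n⊔m; ≤-trans; m≤m+n; 1+n≰n; +-cancelˡ-≡)
open import Data.Product using (∃; _×_; _,_; proj₁; proj₂)
open import Data.Product.Function.NonDependent.Propositional using (_×-⇔_)
open import Data.Sum using (_⊎_; inj₁; inj₂; [_,_]′) renaming (map to map⊎)
open import Data.Sum.Function.Propositional using (_⊎-⇔_)
open import Data.Vec using (Vec; []; _∷_; map; tabulate; toList) renaming (lookup to lookupᵛ)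
open import Data.Vec.Membership.Propositional.Properties using (∈-tabulate⁺; ∈-toList⁺)
open import Data.Vec.Properties using (tabulate-∘; tabulate∘lookup; tabulate-cong; ∷-injective)
open import Function using (_⇔_; mk⇔; _∘_; id; Equivalence; Injective)
open import Function.Construct.Composition using (_⇔-∘_)
open import Function.Construct.Symmetry using (⇔-sym)
open import Function.Related.TypeIsomorphisms using (→-cong-⇔; ¬-cong-⇔)
open import Level using (Level; 0ℓ; Lift; lift; lower)
open import Relation.Binary.PropositionalEquality using (_≡_; _≢_; refl; sym; trans; cong; cong₂; subst; subst₂)
open import Relation.Nullary using (yes; no; contradiction)
open import Relation.Nullary.Decidable using (dec-true; dec-false)
open import Relation.Unary using (Pred; _∈_; _⊆_; _∪_; _∖_; ｛_｝; U)
open import Defs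

open Equivalence using (to; from)

private
  variable
    a b c : Level
    τ : Vocabulary
    X : Pred Var 0ℓ

-- Congruence rules for equivalences

∃-cong-⇔ : {A : Set a} {P : A → Set b} {Q : A → Set c} → (∀ x → P x ⇔ Q x) → ∃ P ⇔ ∃ Q
∃-cong-⇔ h = mk⇔ (λ (x , p) → x , to (h x) p) (λ (x , q) → x , from (h x) q)

∀-cong-⇔ : {A : Set a} {P : A → Set b} {Q : A → Set c} → (∀ x → P x ⇔ Q x) → (∀ x → P x) ⇔ (∀ x → Q x)
∀-cong-⇔ h = mk⇔ (λ p x → to (h x) (p x)) (λ q x → from (h x) (q x))

Lift-⇔ : {A : Set a} → A ⇔ Lift b A
Lift-⇔ = mk⇔ lift lower

≡-cong-⇔ : {A : Set a} {x x′ y y′ : A} → x ≡ x′ → y ≡ y′ → (x ≡ y) ⇔ (x′ ≡ y′)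
≡-cong-⇔ refl refl = mk⇔ id id

subst-⇔ : {A : Set a} (P : A → Set b) {x y : A} → x ≡ y → P x ⇔ P y
subst-⇔ P refl = mk⇔ id id

-- Assignments and variables

infix 4 _≗[_]_
_≗[_]_ : {A : Set} → (Var → A) → Pred Var 0ℓ → (Var → A) → Set
w ≗[ P ] w′ = ∀ v → v ∈ P → w v ≡ w′ v

-- The membership proof x is irrelevant because the membership proofs
-- consumed by ⟦_⟧ᵗ and Tarski are.
Agree : {A : Set} → Pred Var 0ℓ → Asg A X → (Var → A) → Set
Agree {X = X} P t w = ∀ v → v ∈ P → .(x : v ∈ X) → t v x ≡ w v

module _ {A : Set} {P : Pred Var 0ℓ} {t : Asg A X} {w : Var → A} where

  Agree-trans : ∀ {w′} → Agree P t w → w ≗[ P ] w′ → Agree P t w′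
  Agree-trans h e v q x = trans (h v q x) (e v q)

  Agree-≈ : ∀ {t′} → P ⊆ X → t ≈ t′ → Agree P t w → Agree P t′ w
  Agree-≈ P⊆X t≈t′ h v q x = trans (sym (t≈t′ v (P⊆X q))) (h v q x)

  Agree-unique : ∀ {w′} → P ⊆ X → Agree P t w → Agree P t w′ → w ≗[ P ] w′
  Agree-unique P⊆X h h′ v q = trans (sym (h v q (P⊆X q))) (h′ v q (P⊆X q))

module _ {A : Set} (t : Asg A X) (x : Var) (a : A) where

  ↦-same : ∀ {v} .(p : v ∈ X ∪ ｛ x ｝) → x ≡ v → (t [ x ↦ a ]) v p ≡ a
  ↦-same {v} p e with v ≟ x
  ... | yes _  = refl
  ... | no v≢x = contradiction (sym e) v≢x

  ↦-other : ∀ {v} .(p : v ∈ X ∪ ｛ x ｝) .(q : v ∈ X) → x ≢ v → (t [ x ↦ a ]) v p ≡ t v q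
  ↦-other {v} p q x≢v with v ≟ x
  ... | yes e = contradiction (sym e) x≢v
  ... | no _  = refl

↦-cong : {A : Set} {t t′ : Asg A X} (x : Var) (a : A) → t ≈ t′ → t [ x ↦ a ] ≈ t′ [ x ↦ a ]
↦-cong {t = t} {t′} x a e v p with x ≟ v | p
... | yes x≡v | _      = trans (↦-same t x a p x≡v) (sym (↦-same t′ x a p x≡v))
... | no x≢v  | inj₁ q = trans (↦-other t x a p q x≢v) (trans (e v q) (sym (↦-other t′ x a p q x≢v)))
... | no x≢v  | inj₂ x≡v = contradiction x≡v x≢v

strip : ∀ {v x} → x ≢ v → v ∈ X ∪ ｛ x ｝ → v ∈ X
strip x≢v (inj₁ q) = q
strip x≢v (inj₂ e) = ⊥-elim (x≢v e)

-- Extended tuples and fresh variables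

module _ {x⃗ : List Var} {y : Var} where

  ∈-﹔⁺ˡ : (_∈ˡ x⃗) ⊆ (_∈ˡ x⃗ ﹔ y)
  ∈-﹔⁺ˡ q with mem? _≟_ y x⃗
  ... | yes _ = q
  ... | no _  = ∈-++⁺ˡ q

  ∈-﹔⁺ʳ : y ∈ˡ x⃗ ﹔ y
  ∈-﹔⁺ʳ with mem? _≟_ y x⃗
  ... | yes q = q
  ... | no _  = ∈-++⁺ʳ x⃗ (here refl)

  ∈-﹔⁻ : (_∈ˡ x⃗ ﹔ y) ⊆ (_∈ˡ x⃗) ∪ ｛ y ｝
  ∈-﹔⁻ q with mem? _≟_ y x⃗
  ... | yes _ = inj₁ q
  ... | no _ with ∈-++⁻ x⃗ q
  ...   | inj₁ r = inj₁ r
  ...   | inj₂ (here e) = inj₂ (sym e)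

  ﹔⊆∪ : (_∈ˡ x⃗) ⊆ X → (_∈ˡ x⃗ ﹔ y) ⊆ X ∪ ｛ y ｝
  ﹔⊆∪ h = map⊎ h id ∘ ∈-﹔⁻

  ﹔∖⊆∖ : (_∈ˡ x⃗ ﹔ y) ∖ ｛ y ｝ ⊆ (_∈ˡ x⃗) ∖ ｛ y ｝
  ﹔∖⊆∖ (q , y≢v) = strip {X = _∈ˡ x⃗} y≢v (∈-﹔⁻ q) , y≢v

  ∖⊆⇒⊆﹔ : ∀ {P} → P ∖ ｛ y ｝ ⊆ (_∈ˡ x⃗) → P ⊆ (_∈ˡ x⃗ ﹔ y)
  ∖⊆⇒⊆﹔ h q with ∖⊆⇒⊆∪ y h q
  ... | inj₁ r    = ∈-﹔⁺ˡ r
  ... | inj₂ refl = ∈-﹔⁺ʳ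

∈⇒≤max : ∀ {v x⃗} → v ∈ˡ x⃗ → v ≤ foldr _⊔_ 0 x⃗
∈⇒≤max {x⃗ = x ∷ x⃗} (here refl) = m≤m⊔n x (foldr _⊔_ 0 x⃗)
∈⇒≤max {x⃗ = x ∷ x⃗} (there q)   = ≤-trans (∈⇒≤max q) (m≤n⊔m x (foldr _⊔_ 0 x⃗))

-- `freshVars x⃗ k` is the tabulation of this function, so that freshness and distinctness can be
-- stated index by index.
freshVar : List Var → ∀ {k} → Fin k → Var
freshVar x⃗ i = suc (foldr _⊔_ 0 x⃗) + toℕ i

-- The fresh variables start at the successor of the maximum of x⃗, which bounds every entry of x⃗.
freshVar-∉ : ∀ x⃗ {k} (i : Fin k) → freshVar x⃗ i ∉ˡ x⃗
freshVar-∉ x⃗ i q = 1+n≰n (≤-trans (m≤m+n (suc (foldr _⊔_ 0 x⃗)) (toℕ i)) (∈⇒≤max q))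

freshVar-injective : ∀ x⃗ {k} → Injective _≡_ _≡_ (freshVar x⃗ {k})
freshVar-injective x⃗ e = toℕ-injective (+-cancelˡ-≡ (suc (foldr _⊔_ 0 x⃗)) _ _ e)

module _ (𝔄 : Structure τ) where

  private
    A = dom 𝔄

  -- Updates of total assignments

  update-same : ∀ (w : Var → A) {x v} a → x ≡ v → update 𝔄 w x a v ≡ a
  update-same w {x} {v} a e = cong (if_then a else w v) (dec-true (v ≟ x) (sym e))

  update-other : ∀ (w : Var → A) {x v} a → x ≢ v → update 𝔄 w x a v ≡ w v
  update-other w {x} {v} a x≢v = cong (if_then a else w v) (dec-false (v ≟ x) (x≢v ∘ sym))

  update-cong : ∀ {P} {w w′ : Var → A} x a → w ≗[ P ∖ ｛ x ｝ ] w′ → update 𝔄 w x a ≗[ P ] update 𝔄 w′ x a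
  update-cong {w = w} {w′} x a h v q with x ≟ v
  ... | yes e = trans (update-same w a e) (sym (update-same w′ a e))
  ... | no ¬e = trans (update-other w a ¬e) (trans (h v (q , ¬e)) (sym (update-other w′ a ¬e)))

  update-self : ∀ (w : Var → A) x v → update 𝔄 w x (w x) v ≡ w v
  update-self w x v with x ≟ v
  ... | yes refl = update-same w (w x) refl
  ... | no ¬e    = update-other w (w x) ¬e

  -- This is the step under a quantifier: x receives the same value on both sides, so only agreement
  -- at the other variables is required beforehand.
  Agree-↦ : ∀ {P} {t : Asg A X} {w} x a → Agree (P ∖ ｛ x ｝) t w → Agree P (t [ x ↦ a ]) (update 𝔄 w x a)
  Agree-↦ {X = X} {t = t} {w} x a h v q p with x ≟ v
  ... | yes e = trans (↦-same t x a p e) (sym (update-same w a e))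
  ... | no ¬e = trans (↦-other t x a p (strip {X = X} ¬e p) ¬e)
                      (trans (h v (q , ¬e) (strip {X = X} ¬e p)) (sym (update-other w a ¬e)))

  -- Coincidence

  mutual
    ⟦⟧ᵗ-eval : ∀ {t : Asg A X} {w} e .(p : FVᵗ e ⊆ X) → Agree (FVᵗ e) t w → ⟦_⟧ᵗ 𝔄 t e p ≡ eval 𝔄 w e
    ⟦⟧ᵗ-eval (var x)    p h = h x refl (p refl)
    ⟦⟧ᵗ-eval (fun f ts) p h = cong (funᴵ 𝔄 f) (⟦⟧ᵗˢ-evals ts p h)

    ⟦⟧ᵗˢ-evals : ∀ {t : Asg A X} {w k} (ts : Vec _ k) .(p : FVᵗˢ ts ⊆ X) →
                 Agree (FVᵗˢ ts) t w → ⟦_⟧ᵗˢ 𝔄 t ts p ≡ evals 𝔄 w ts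
    ⟦⟧ᵗˢ-evals []       p h = refl
    ⟦⟧ᵗˢ-evals (e ∷ ts) p h = cong₂ _∷_
      (⟦⟧ᵗ-eval e (λ q → p (inj₁ q)) (λ v q → h v (inj₁ q)))
      (⟦⟧ᵗˢ-evals ts (λ q → p (inj₂ q)) (λ v q → h v (inj₂ q)))

  -- Both sides equal the value of `ts` under `w` regarded as an assignment with domain `U`.
  evals-cong : ∀ {w w′ k} (ts : Vec (Term τ) k) → w ≗[ FVᵗˢ ts ] w′ → evals 𝔄 w ts ≡ evals 𝔄 w′ ts
  evals-cong {w} ts h = trans
    (sym (⟦⟧ᵗˢ-evals {X = U} {t = λ v _ → w v} ts _ (λ _ _ _ → refl)))
    (⟦⟧ᵗˢ-evals ts _ (λ v q _ → h v q))

  evals-vars-cong : ∀ {w w′} x⃗ → w ≗[ _∈ˡ x⃗ ] w′ → evals 𝔄 w (vars x⃗) ≡ evals 𝔄 w′ (vars x⃗)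
  evals-vars-cong x⃗ h = evals-cong (vars x⃗) (λ v q → h v (FV-vars x⃗ q))

  evals-map-var : ∀ {k} w (zs : Vec Var k) → evals 𝔄 w (map var zs) ≡ map w zs
  evals-map-var w []       = refl
  evals-map-var w (z ∷ zs) = cong (w z ∷_) (evals-map-var w zs)

  Tarski-embed : ∀ {Γ} {ρ : PredEnv 𝔄 Γ} {t : Asg A X} {w} α .(p : FVᶠ α ⊆ X) →
                 Agree (FVᶠ α) t w → Tarski 𝔄 t α p ⇔ SatSO 𝔄 ρ w (embed α)
  Tarski-embed ⊤′ p h = Lift-⇔
  Tarski-embed (t ≐′ u) p h = Lift-⇔ ⇔-∘ ≡-cong-⇔
    (⟦⟧ᵗ-eval t (λ q → p (inj₁ q)) (λ v q → h v (inj₁ q)))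
    (⟦⟧ᵗ-eval u (λ q → p (inj₂ q)) (λ v q → h v (inj₂ q)))
  Tarski-embed (rel r ts) p h = Lift-⇔ ⇔-∘ subst-⇔ (relᴵ 𝔄 r) (⟦⟧ᵗˢ-evals ts p h)
  Tarski-embed (¬′ α) p h = ¬-cong-⇔ (Tarski-embed α p h)
  Tarski-embed (α ∧′ β) p h =
    Tarski-embed α (λ q → p (inj₁ q)) (λ v q → h v (inj₁ q)) ×-⇔
    Tarski-embed β (λ q → p (inj₂ q)) (λ v q → h v (inj₂ q))
  Tarski-embed (α ∨′ β) p h =
    Tarski-embed α (λ q → p (inj₁ q)) (λ v q → h v (inj₁ q)) ⊎-⇔
    Tarski-embed β (λ q → p (inj₂ q)) (λ v q → h v (inj₂ q))
  Tarski-embed (α ⇒′ β) p h = →-cong-⇔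
    (Tarski-embed α (λ q → p (inj₁ q)) (λ v q → h v (inj₁ q)))
    (Tarski-embed β (λ q → p (inj₂ q)) (λ v q → h v (inj₂ q)))
  Tarski-embed (∃′ x α) p h = ∃-cong-⇔ λ a → Tarski-embed α (∖⊆⇒⊆∪ x p) (Agree-↦ x a h)
  Tarski-embed (∀′ x α) p h = ∀-cong-⇔ λ a → Tarski-embed α (∖⊆⇒⊆∪ x p) (Agree-↦ x a h)

  module _ {k} {pt : A} {fs : (f : Fun (⟨P⟩ k)) → Vec A (arF (⟨P⟩ k) f) → A} {Q : Pred (Vec A k) 0ℓ} where

    private
      -- The interpretation `fs` of the empty set of function symbols stays arbitrary, so that the
      -- structure built in `HoldsFor` is an instance.
      𝔓 : Structure (⟨P⟩ k)
      𝔓 = record { dom = A ; point = pt ; funᴵ = fs ; relᴵ = λ _ → Q }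

    ⟦⟧ᵗ-termP : ∀ {t : Asg A X} {w} e .(p : FVᵗ e ⊆ X) →
                Agree (FVᵗ e) t w → ⟦_⟧ᵗ 𝔓 t e p ≡ eval 𝔄 w (termP e)
    ⟦⟧ᵗ-termP (var x) p h = h x refl (p refl)

    ⟦⟧ᵗˢ-termP : ∀ {t : Asg A X} {w n} (ts : Vec _ n) .(p : FVᵗˢ ts ⊆ X) →
                 Agree (FVᵗˢ ts) t w → ⟦_⟧ᵗˢ 𝔓 t ts p ≡ evals 𝔄 w (map termP ts)
    ⟦⟧ᵗˢ-termP []       p h = refl
    ⟦⟧ᵗˢ-termP (e ∷ ts) p h = cong₂ _∷_
      (⟦⟧ᵗ-termP e (λ q → p (inj₁ q)) (λ v q → h v (inj₁ q)))
      (⟦⟧ᵗˢ-termP ts (λ q → p (inj₂ q)) (λ v q → h v (inj₂ q)))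

    module _ {Γ} {ρ : PredEnv 𝔄 Γ} {S : k ∈ˡ Γ} (Q⇔S : ∀ a⃗ → Q a⃗ ⇔ lookup ρ S a⃗) where

      -- Pointwise equivalence of Q and S is the right hypothesis, because the defining conjunct in
      -- `η` determines S only up to that.
      Tarski-replaceP : ∀ {t : Asg A X} {w} α .(p : FVᶠ α ⊆ X) →
                        Agree (FVᶠ α) t w → Tarski 𝔓 t α p ⇔ SatSO 𝔄 ρ w (replaceP S α)
      Tarski-replaceP ⊤′ p h = Lift-⇔
      Tarski-replaceP (t ≐′ u) p h = Lift-⇔ ⇔-∘ ≡-cong-⇔
        (⟦⟧ᵗ-termP t (λ q → p (inj₁ q)) (λ v q → h v (inj₁ q)))
        (⟦⟧ᵗ-termP u (λ q → p (inj₂ q)) (λ v q → h v (inj₂ q)))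
      Tarski-replaceP (rel r ts) p h = Lift-⇔ ⇔-∘ (Q⇔S _ ⇔-∘ subst-⇔ Q (⟦⟧ᵗˢ-termP ts p h))
      Tarski-replaceP (¬′ α) p h = ¬-cong-⇔ (Tarski-replaceP α p h)
      Tarski-replaceP (α ∧′ β) p h =
        Tarski-replaceP α (λ q → p (inj₁ q)) (λ v q → h v (inj₁ q)) ×-⇔
        Tarski-replaceP β (λ q → p (inj₂ q)) (λ v q → h v (inj₂ q))
      Tarski-replaceP (α ∨′ β) p h =
        Tarski-replaceP α (λ q → p (inj₁ q)) (λ v q → h v (inj₁ q)) ⊎-⇔
        Tarski-replaceP β (λ q → p (inj₂ q)) (λ v q → h v (inj₂ q))
      Tarski-replaceP (α ⇒′ β) p h = →-cong-⇔
        (Tarski-replaceP α (λ q → p (inj₁ q)) (λ v q → h v (inj₁ q)))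
        (Tarski-replaceP β (λ q → p (inj₂ q)) (λ v q → h v (inj₂ q)))
      Tarski-replaceP (∃′ x α) p h = ∃-cong-⇔ λ a → Tarski-replaceP α (∖⊆⇒⊆∪ x p) (Agree-↦ x a h)
      Tarski-replaceP (∀′ x α) p h = ∀-cong-⇔ λ a → Tarski-replaceP α (∖⊆⇒⊆∪ x p) (Agree-↦ x a h)

  -- A dependency is a sentence, so the empty assignment agrees with every `w` on its free
  -- variables.
  HoldsFor-replaceP : ∀ D {pt : A} {Q Γ} {ρ : PredEnv 𝔄 Γ} {S w} → (∀ a⃗ → Q a⃗ ⇔ lookup ρ S a⃗) →
                      HoldsFor D pt Q ⇔ SatSO 𝔄 ρ w (replaceP S (δ D))
  HoldsFor-replaceP D Q⇔S = Tarski-replaceP Q⇔S (δ D) (sentence D) (λ v q → ⊥-elim (sentence D q))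

  -- Blocks of first-order quantifiers

  -- Successive updates make this exactly the assignment reached from `u` when the quantifiers over
  -- x⃗ are instantiated with the values of `w`.
  override : (Var → A) → List Var → (Var → A) → Var → A
  override u []       w = u
  override u (x ∷ x⃗) w = override (update 𝔄 u x (w x)) x⃗ w

  -- The disjunction is the induction invariant: a variable that already has its value from `w`
  -- keeps it, since a later update at a repeated entry assigns the same value.
  override-keep : ∀ u x⃗ w v → u v ≡ w v ⊎ v ∈ˡ x⃗ → override u x⃗ w v ≡ w v
  override-keep u []       w v (inj₁ e) = e
  override-keep u (x ∷ x⃗) w v h with x ≟ v | h
  ... | yes refl | _ = override-keep _ x⃗ w v (inj₁ (update-same u (w x) refl))
  ... | no x≢v | inj₁ e = override-keep _ x⃗ w v (inj₁ (trans (update-other u (w x) x≢v) e))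
  ... | no x≢v | inj₂ (here e) = contradiction (sym e) x≢v
  ... | no x≢v | inj₂ (there q) = override-keep _ x⃗ w v (inj₂ q)

  override-∈ : ∀ u x⃗ w → override u x⃗ w ≗[ _∈ˡ x⃗ ] w
  override-∈ u x⃗ w v q = override-keep u x⃗ w v (inj₂ q)

  override-∉ : ∀ u x⃗ w → override u x⃗ w ≗[ _∉ˡ x⃗ ] u
  override-∉ u []       w v q = refl
  override-∉ u (x ∷ x⃗) w v q = trans
    (override-∉ (update 𝔄 u x (w x)) x⃗ w v (q ∘ there))
    (update-other u (w x) (λ e → q (here (sym e))))

  module _ {Γ} {ρ : PredEnv 𝔄 Γ} {α : SO τ Γ} where

    ∀⃗-intro : ∀ x⃗ {u} → (∀ w → SatSO 𝔄 ρ w α) → SatSO 𝔄 ρ u (∀⃗ x⃗ α)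
    ∀⃗-intro []       h   = h _
    ∀⃗-intro (x ∷ x⃗) h a = ∀⃗-intro x⃗ h

    ∀⃗-elim : ∀ x⃗ {u} w → SatSO 𝔄 ρ u (∀⃗ x⃗ α) → SatSO 𝔄 ρ (override u x⃗ w) α
    ∀⃗-elim []       w h = h
    ∀⃗-elim (x ∷ x⃗) w h = ∀⃗-elim x⃗ w (h (w x))

    -- The block reaches only the assignments that differ from `u` on x⃗; invariance of `P` extends
    -- the conclusion to all assignments.
    ∀⃗-⇔ : ∀ {p} {P : (Var → A) → Set p} x⃗ {u} → (∀ {w w′} → w ≗[ _∈ˡ x⃗ ] w′ → P w → P w′) →
          (∀ w → SatSO 𝔄 ρ w α ⇔ P w) → SatSO 𝔄 ρ u (∀⃗ x⃗ α) ⇔ (∀ w → P w)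
    ∀⃗-⇔ x⃗ {u} inv h = mk⇔
      (λ s w → inv (override-∈ u x⃗ w) (to (h _) (∀⃗-elim x⃗ w s)))
      (λ p → ∀⃗-intro x⃗ (λ w → from (h w) (p w)))

    ∃⃗-intro : ∀ x⃗ {u} w → SatSO 𝔄 ρ (override u x⃗ w) α → SatSO 𝔄 ρ u (∃⃗ x⃗ α)
    ∃⃗-intro []       w h = h
    ∃⃗-intro (x ∷ x⃗) w h = w x , ∃⃗-intro x⃗ w h

    -- The agreement with `u` outside x⃗ is recorded for the variables z⃗ of a dependency atom,
    -- which are free under this block.
    ∃⃗-elim : ∀ x⃗ {u} → SatSO 𝔄 ρ u (∃⃗ x⃗ α) → ∃ λ w → w ≗[ _∉ˡ x⃗ ] u × SatSO 𝔄 ρ w α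
    ∃⃗-elim []       h = _ , (λ _ _ → refl) , h
    ∃⃗-elim (x ∷ x⃗) {u} (a , h) with ∃⃗-elim x⃗ h
    ... | w , off , s = w ,
      (λ v q → trans (off v (q ∘ there)) (update-other u a (λ e → q (here (sym e))))) , s

  ⇔²-⇔ : ∀ {Γ} {ρ : PredEnv 𝔄 Γ} {α β w p q} {P : Set p} {Q : Set q} → SatSO 𝔄 ρ w α ⇔ P →
         SatSO 𝔄 ρ w β ⇔ Q → SatSO 𝔄 ρ w (α ⇔² β) ⇔ (P ⇔ Q)
  ⇔²-⇔ h k = mk⇔
    (λ (f , g) → mk⇔ (to k ∘ f ∘ from h) (to h ∘ g ∘ from k))
    (λ e → from k ∘ to e ∘ to h , from h ∘ from e ∘ to k)

  ≐⃗-⇔ : ∀ {Γ} {ρ : PredEnv 𝔄 Γ} {w k} (ts us : Vec (Term τ) k) →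
        SatSO 𝔄 ρ w (ts ≐⃗ us) ⇔ (evals 𝔄 w ts ≡ evals 𝔄 w us)
  ≐⃗-⇔ []       []       = mk⇔ (λ _ → refl) (λ _ → lift _)
  ≐⃗-⇔ (t ∷ ts) (u ∷ us) = mk⇔
    (λ (e , es) → cong₂ _∷_ (lower e) (to (≐⃗-⇔ ts us) es))
    (λ e → lift (proj₁ (∷-injective e)) , from (≐⃗-⇔ ts us) (proj₂ (∷-injective e)))

  -- Search for an index of the given variable; injectivity makes the index that is found the
  -- intended one.
  interpolate : ∀ {k} {f : Fin k → Var} → Injective _≡_ _≡_ f → (g : Fin k → A) →
                ∃ λ w → ∀ i → w (f i) ≡ g i
  interpolate {k} {f} inj g = w , w-f
    where
    w : Var → A
    w v with any? (λ i → f i ≟ v)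
    ... | yes (i , _) = g i
    ... | no _        = point 𝔄

    w-f : ∀ i → w (f i) ≡ g i
    w-f i with any? (λ j → f j ≟ f i)
    ... | yes (j , e) = cong g (inj e)
    ... | no ¬e       = contradiction (i , refl) ¬e

  -- Teams and their sets of tuples

  -- Bridges the assignments of a team, which have a domain, and the total ones of second-order
  -- logic; `point` fills in the values outside x⃗.
  totalise : ∀ x⃗ → (_∈ˡ x⃗) ⊆ X → (t : Asg A X) → ∃ λ w → Agree (_∈ˡ x⃗) t w
  totalise {X = X} x⃗ x⃗⊆X t = w , agree
    where
    w : Var → A
    w v with mem? _≟_ v x⃗
    ... | yes q = t v (x⃗⊆X q)
    ... | no _  = point 𝔄

    agree : Agree (_∈ˡ x⃗) t w
    agree v q x with mem? _≟_ v x⃗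
    ... | yes _ = refl
    ... | no ¬q = contradiction q ¬q

  Holds : ∀ x⃗ → Pred (Vec A _) 0ℓ → (Var → A) → Set
  Holds x⃗ Q w = Q (evals 𝔄 w (vars x⃗))

  Holds-cong : ∀ x⃗ Q {w w′} → w ≗[ _∈ˡ x⃗ ] w′ → Holds x⃗ Q w → Holds x⃗ Q w′
  Holds-cong x⃗ Q h = subst Q (evals-vars-cong x⃗ h)

  -- For P = x⃗ this is membership of the tuple of `w` in x⃗⟨T⟩; for P = x⃗ without y it is
  -- membership in the projection that forgets y.
  Trace : Pred Var 0ℓ → Team A X → (Var → A) → Set
  Trace P T w = ∃ λ t → t ∈ᵀ T × Agree P t w

  -- Q = x⃗⟨T⟩, except that if x⃗ has repetitions then nothing is said about
  -- the tuples that are not the value of x⃗ under any assignment: η does not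
  -- constrain its quantified predicates there.
  Describes : ∀ x⃗ → Pred (Vec A _) 0ℓ → Team A X → Set
  Describes x⃗ Q T = ∀ w → Holds x⃗ Q w ⇔ Trace (_∈ˡ x⃗) T w

  Agree-vars : ∀ {t : Asg A X} {w} x⃗ .(p : FVᵗˢ (vars {τ} x⃗) ⊆ X) →
               ⟦_⟧ᵗˢ 𝔄 t (vars x⃗) p ≡ evals 𝔄 w (vars x⃗) → Agree (_∈ˡ x⃗) t w
  Agree-vars (x ∷ x⃗) p e v (here refl) _ = proj₁ (∷-injective e)
  Agree-vars (x ∷ x⃗) p e v (there q)   y = Agree-vars x⃗ (λ r → p (inj₂ r)) (proj₂ (∷-injective e)) v q y

  describes-tupleValues : ∀ x⃗ (x⃗⊆X : (_∈ˡ x⃗) ⊆ X) (T : Team A X) → Describes x⃗ (tupleValues 𝔄 x⃗ x⃗⊆X T) T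
  describes-tupleValues x⃗ x⃗⊆X T w = mk⇔
    (λ (t , t∈T , e) → t , t∈T , Agree-vars x⃗ (λ q → x⃗⊆X (FV-vars x⃗ q)) e)
    (λ (t , t∈T , h) → t , t∈T ,
      ⟦⟧ᵗˢ-evals (vars x⃗) (λ q → x⃗⊆X (FV-vars x⃗ q)) (λ v q → h v (FV-vars x⃗ q)))

  -- t(x⃗) ∈ Q
  Selects : ∀ x⃗ → Pred (Vec A _) 0ℓ → Asg A X → Set
  Selects x⃗ Q t = ∃ λ w → Agree (_∈ˡ x⃗) t w × Holds x⃗ Q w

  module _ (x⃗ : List Var) (x⃗⊆X : (_∈ˡ x⃗) ⊆ X) (Q : Pred (Vec A (length x⃗)) 0ℓ) where

    Selects-≈ : ∀ {t t′} → t ≈ t′ → Selects x⃗ Q t → Selects x⃗ Q t′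
    Selects-≈ e (w , h , q) = w , Agree-≈ x⃗⊆X e h , q

    -- All total assignments that agree with t on x⃗ give x⃗ the same value, so the witness inside
    -- `Selects` can be exchanged for any other.
    Selects⇒Holds : ∀ {t w} → Agree (_∈ˡ x⃗) t w → Selects x⃗ Q t → Holds x⃗ Q w
    Selects⇒Holds h (w′ , h′ , q) = Holds-cong x⃗ Q (Agree-unique x⃗⊆X h′ h) q

    restrict : Team A X → Team A X
    mem  (restrict T) t = t ∈ᵀ T × Selects x⃗ Q t
    resp (restrict T) e (t∈T , q) = resp T e t∈T , Selects-≈ e q

    describes-restrict : ∀ {T} → (∀ w → Holds x⃗ Q w → Trace (_∈ˡ x⃗) T w) → Describes x⃗ Q (restrict T)
    describes-restrict sub w = mk⇔
      (λ q → let t , t∈T , h = sub w q in t , (t∈T , w , h , q) , h)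
      (λ (t , (_ , s) , h) → Selects⇒Holds h s)

  -- Semantic form of the conjuncts that relate predicates in the translation

  ∃-Holds : Var → ∀ x⃗ → Pred (Vec A _) 0ℓ → (Var → A) → Set
  ∃-Holds y x⃗ Q w = ∃ λ a → Holds x⃗ Q (update 𝔄 w y a)

  ∃-Holds-cong : ∀ {y} x⃗ Q {w w′} → w ≗[ (_∈ˡ x⃗) ∖ ｛ y ｝ ] w′ → ∃-Holds y x⃗ Q w → ∃-Holds y x⃗ Q w′
  ∃-Holds-cong {y} x⃗ Q h (a , q) = a , Holds-cong x⃗ Q (update-cong y a h) q

  ∃-Holds-⇔ : ∀ {y} x⃗ Q {w w′} → w ≗[ (_∈ˡ x⃗) ∖ ｛ y ｝ ] w′ → ∃-Holds y x⃗ Q w ⇔ ∃-Holds y x⃗ Q w′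
  ∃-Holds-⇔ x⃗ Q h = mk⇔ (∃-Holds-cong x⃗ Q h) (∃-Holds-cong x⃗ Q (λ v q → sym (h v q)))

  -- The biconditional conjunct shared by the clauses for ∃ and ∀; `Covers` below is the additional
  -- conjunct for ∀.
  Linked : ∀ y x⃗ → Pred (Vec A _) 0ℓ → Pred (Vec A _) 0ℓ → Set
  Linked y x⃗ Q Q′ = ∀ w → ∃-Holds y x⃗ Q w ⇔ ∃-Holds y (x⃗ ﹔ y) Q′ w

  Covers : ∀ y x⃗ → Pred (Vec A _) 0ℓ → Pred (Vec A _) 0ℓ → Set
  Covers y x⃗ Q Q′ = ∀ w → Holds x⃗ Q w → ∀ a → Holds (x⃗ ﹔ y) Q′ (update 𝔄 w y a)

  SatSO-splits : ∀ x⃗ {Γ} {ρ : PredEnv 𝔄 Γ} {u R S V} →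
    SatSO 𝔄 ρ u (∀⃗ x⃗ (pred R (vars x⃗) ⇔² (pred S (vars x⃗) ∨² pred V (vars x⃗)))) ⇔
    (∀ w → Holds x⃗ (lookup ρ R) w ⇔ (Holds x⃗ (lookup ρ S) w ⊎ Holds x⃗ (lookup ρ V) w))
  SatSO-splits x⃗ {ρ = ρ} {R = R} {S} {V} = ∀⃗-⇔ x⃗
    (λ h → subst (λ a⃗ → lookup ρ R a⃗ ⇔ (lookup ρ S a⃗ ⊎ lookup ρ V a⃗)) (evals-vars-cong x⃗ h))
    (λ w → ⇔²-⇔ {ρ = ρ} {α = pred R (vars x⃗)} {β = pred S (vars x⃗) ∨² pred V (vars x⃗)}
             (⇔-sym Lift-⇔) (⇔-sym Lift-⇔ ⊎-⇔ ⇔-sym Lift-⇔))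

  module _ {Γ} {ρ : PredEnv 𝔄 Γ} {u : Var → A} (y : Var) (x⃗ : List Var)
           {R : length x⃗ ∈ˡ Γ} {S : length (x⃗ ﹔ y) ∈ˡ Γ} where

    SatSO-linked : SatSO 𝔄 ρ u (∀⃗ x⃗ (∃¹ y (pred R (vars x⃗)) ⇔² ∃¹ y (pred S (vars (x⃗ ﹔ y))))) ⇔
                   Linked y x⃗ (lookup ρ R) (lookup ρ S)
    SatSO-linked = ∀⃗-⇔ x⃗
      -- Both existential statements ignore the old value of y, and every other entry of x⃗;y lies
      -- in x⃗, so they depend on the values at x⃗ only.
      (λ h e → ∃-Holds-⇔ (x⃗ ﹔ y) (lookup ρ S) (λ v q → h v (proj₁ (﹔∖⊆∖ q)))
               ⇔-∘ (e ⇔-∘ ⇔-sym (∃-Holds-⇔ x⃗ (lookup ρ R) (λ v q → h v (proj₁ q)))))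
      (λ w → ⇔²-⇔ {ρ = ρ} {α = ∃¹ y (pred R (vars x⃗))} {β = ∃¹ y (pred S (vars (x⃗ ﹔ y)))}
               (∃-cong-⇔ λ _ → ⇔-sym Lift-⇔) (∃-cong-⇔ λ _ → ⇔-sym Lift-⇔))

    SatSO-covers : SatSO 𝔄 ρ u (∀⃗ x⃗ (pred R (vars x⃗) ⇒² ∀¹ y (pred S (vars (x⃗ ﹔ y))))) ⇔
                   Covers y x⃗ (lookup ρ R) (lookup ρ S)
    SatSO-covers = ∀⃗-⇔ x⃗
      (λ h c q a → Holds-cong (x⃗ ﹔ y) (lookup ρ S) (update-cong y a (λ v r → h v (proj₁ (﹔∖⊆∖ r))))
                     (c (Holds-cong x⃗ (lookup ρ R) (λ v r → sym (h v r)) q) a))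
      (λ w → →-cong-⇔ (⇔-sym Lift-⇔) (∀-cong-⇔ λ _ → ⇔-sym Lift-⇔))

  -- Quantifiers and supplemented teams

  module Quantifier (x⃗ : List Var) (x⃗⊆X : (_∈ˡ x⃗) ⊆ X) (y : Var)
                    (Q : Pred (Vec A (length x⃗)) 0ℓ) (T : Team A X) (desc : Describes x⃗ Q T) where

    private
      y⃗ = x⃗ ﹔ y

    Agree-↦-﹔ : ∀ {t : Asg A X} {w} a → Agree ((_∈ˡ x⃗) ∖ ｛ y ｝) t w → Agree (_∈ˡ y⃗) (t [ y ↦ a ]) (update 𝔄 w y a)
    Agree-↦-﹔ a h = Agree-↦ y a (λ v q → h v (﹔∖⊆∖ q))

    ∃-Holds-trace : ∀ w → ∃-Holds y x⃗ Q w ⇔ Trace ((_∈ˡ x⃗) ∖ ｛ y ｝) T w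
    ∃-Holds-trace w = mk⇔
      (λ (a , q) → let t , t∈T , h = to (desc _) q in
        t , t∈T , λ v (r , ¬e) x → trans (h v r x) (update-other w a ¬e))
      λ (t , t∈T , h) → let w₀ , h₀ = totalise x⃗ x⃗⊆X t in
        -- If y occurs in x⃗, then `w₀ y` is the value of y under t, which restores the tuple of t;
        -- otherwise the tuple does not mention y.
        w₀ y , from (desc _) (t , t∈T , agree h h₀)
      where
      agree : ∀ {t w₀} → Agree ((_∈ˡ x⃗) ∖ ｛ y ｝) t w → Agree (_∈ˡ x⃗) t w₀ → Agree (_∈ˡ x⃗) t (update 𝔄 w y (w₀ y))
      agree h h₀ v q x with y ≟ v
      ... | yes refl = trans (h₀ v q x) (sym (update-same w _ refl))
      ... | no ¬e    = trans (h v (q , ¬e) x) (sym (update-other w _ ¬e))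

    -- Both sides say that some member of T agrees with `w` on x⃗ apart from y.
    describes⇒linked : ∀ Q′ f → Describes y⃗ Q′ (T ⟨ y ≔ f ⟩) → Linked y x⃗ Q Q′
    describes⇒linked Q′ f desc′ w = ⇔-sym trace′ ⇔-∘ ∃-Holds-trace w
      where
      trace′ : ∃-Holds y y⃗ Q′ w ⇔ Trace ((_∈ˡ x⃗) ∖ ｛ y ｝) T w
      trace′ = mk⇔
        (λ (a , q) → let t′ , (t , t∈T , b , _ , e) , h = to (desc′ _) q in
          t , t∈T , λ v (r , ¬e) x → trans (sym (↦-other t y b (inj₁ x) x ¬e))
            (trans (sym (e v (inj₁ (x⃗⊆X r))))
              (trans (h v (∈-﹔⁺ˡ r) (inj₁ x)) (update-other w a ¬e))))
        -- Nonemptiness of f(t) guarantees that t has an extension in the supplemented team.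
        (λ (t , t∈T , h) → let b , b∈f = nonempty f t∈T in
          b , from (desc′ _) (t [ y ↦ b ] , (t , t∈T , b , b∈f , λ _ _ → refl) , Agree-↦-﹔ b h))

    module _ (Q′ : Pred (Vec A (length y⃗)) 0ℓ) (linked : Linked y x⃗ Q Q′) where

      -- The value `w y` witnesses ∃y S(x⃗;y), so the link yields a member of T that agrees with `w`
      -- on x⃗ apart from y; setting y to `w y` removes the difference.
      linked⇒trace : ∀ w → Holds y⃗ Q′ w → ∃ λ t → t ∈ᵀ T × Agree (_∈ˡ y⃗) (t [ y ↦ w y ]) w
      linked⇒trace w q =
        let q′          = Holds-cong y⃗ Q′ (λ v _ → sym (update-self w y v)) q
            t , t∈T , h = to (∃-Holds-trace w) (from (linked w) (w y , q′))
        in t , t∈T , Agree-trans (Agree-↦-﹔ (w y) h) (λ v _ → update-self w y v)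

      supplement : Supplement T
      choice   supplement t a = Selects y⃗ Q′ (t [ y ↦ a ])
      respects supplement _ e = Selects-≈ y⃗ (﹔⊆∪ x⃗⊆X) Q′ (↦-cong y _ e)
      nonempty supplement {t} t∈T =
        let w , h  = totalise x⃗ x⃗⊆X t
            h′     = λ v (q : v ∈ (_∈ˡ x⃗) ∖ ｛ y ｝) → h v (proj₁ q)
            a , q′ = to (linked w) (from (∃-Holds-trace w) (t , t∈T , h′))
        in a , update 𝔄 w y a , Agree-↦-﹔ a h′ , q′

      describes-supplement : Describes y⃗ Q′ (T ⟨ y ≔ supplement ⟩)
      describes-supplement w = mk⇔
        (λ q → let t , t∈T , h = linked⇒trace w q in
          t [ y ↦ w y ] , (t , t∈T , w y , (w , h , q) , λ _ _ → refl) , h)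
        (λ (t′ , (t , _ , a , s , e) , h) →
          Selects⇒Holds y⃗ (﹔⊆∪ x⃗⊆X) Q′ (Agree-≈ (﹔⊆∪ x⃗⊆X) e h) s)

      -- The link gives one inclusion and `Covers` the other.
      describes-full : ∀ a₀ → Covers y x⃗ Q Q′ →
                       Describes y⃗ Q′ (T ⟨ y ≔ full T a₀ ⟩)
      describes-full a₀ all w = mk⇔
        (λ q → let t , t∈T , h = linked⇒trace w q in
          t [ y ↦ w y ] , (t , t∈T , w y , _ , λ _ _ → refl) , h)
        (λ (t′ , (t , t∈T , a , _ , e) , h) →
          let w₀ , h₀ = totalise x⃗ x⃗⊆X t
              h₁      = Agree-↦-﹔ a (λ v (q : v ∈ (_∈ˡ x⃗) ∖ ｛ y ｝) → h₀ v (proj₁ q))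
          in Holds-cong y⃗ Q′ (Agree-unique (﹔⊆∪ x⃗⊆X) h₁ (Agree-≈ (﹔⊆∪ x⃗⊆X) e h))
               (all w₀ (from (desc w₀) (t , t∈T , h₀)) a))

    describes-full⇒covers : ∀ Q′ a₀ → Describes y⃗ Q′ (T ⟨ y ≔ full T a₀ ⟩) →
                            Covers y x⃗ Q Q′
    describes-full⇒covers Q′ a₀ desc′ w q a = let t , t∈T , h = to (desc w) q in
      from (desc′ _) (t [ y ↦ a ] , (t , t∈T , a , _ , λ _ _ → refl) , Agree-↦-﹔ a (λ v (r , _) → h v r))

  -- Dependency atoms

  evals-freshVars : ∀ x⃗ {k} w → evals 𝔄 w (map var (freshVars x⃗ k)) ≡ tabulate (w ∘ freshVar x⃗)
  evals-freshVars x⃗ {k} w = trans (evals-map-var w (freshVars x⃗ k)) (sym (tabulate-∘ w (freshVar x⃗)))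

  evals-fresh-cong : ∀ x⃗ {k} {w w′ : Var → A} → (∀ i → w (freshVar x⃗ {k} i) ≡ w′ (freshVar x⃗ i)) →
                     evals 𝔄 w (map var (freshVars x⃗ k)) ≡ evals 𝔄 w′ (map var (freshVars x⃗ k))
  evals-fresh-cong x⃗ {w = w} {w′} h =
    trans (evals-freshVars x⃗ w) (trans (tabulate-cong h) (sym (evals-freshVars x⃗ w′)))

  -- The fresh variables are pairwise distinct, hence can take the entries of any tuple as values.
  evals-fresh-surjective : ∀ x⃗ {k} (a⃗ : Vec A k) → ∃ λ w → evals 𝔄 w (map var (freshVars x⃗ k)) ≡ a⃗
  evals-fresh-surjective x⃗ a⃗ =
    let w , e = interpolate (freshVar-injective x⃗) (lookupᵛ a⃗)
    in w , trans (evals-freshVars x⃗ w) (trans (tabulate-cong e) (tabulate∘lookup a⃗))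

  module _ (x⃗ : List Var) (x⃗⊆X : (_∈ˡ x⃗) ⊆ X) {k} (ts : Vec (Term τ) k) (fv : FVᵗˢ ts ⊆ (_∈ˡ x⃗))
           .(p : FVᵗˢ ts ⊆ X) {Γ} {ρ : PredEnv 𝔄 Γ} {R : length x⃗ ∈ˡ Γ} (T : Team A X)
           (desc : Describes x⃗ (lookup ρ R) T) where

    private
      z⃗ : Vec (Term τ) k
      z⃗ = map var (freshVars x⃗ k)

    SatSO-values : ∀ w → SatSO 𝔄 ρ w (∃⃗ x⃗ (pred R (vars x⃗) ∧² (ts ≐⃗ z⃗))) ⇔ values 𝔄 ts p T (evals 𝔄 w z⃗)
    SatSO-values w = mk⇔
      (λ s → let w′ , off , r , e = ∃⃗-elim {ρ = ρ} {α = pred R (vars x⃗) ∧² (ts ≐⃗ z⃗)} x⃗ s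
                 t , t∈T , h      = to (desc w′) (lower r)
             in t , t∈T , trans (⟦⟧ᵗˢ-evals ts p (λ v q → h v (fv q)))
                            (trans (to (≐⃗-⇔ ts z⃗) e)
                              -- No fresh variable lies in x⃗, so the block of quantifiers over x⃗
                              -- leaves the value of z⃗ unchanged.
                              (evals-fresh-cong x⃗ (λ i → off _ (freshVar-∉ x⃗ i)))))
      (λ (t , t∈T , e) →
        let w₀ , h₀ = totalise x⃗ x⃗⊆X t
            o       = override w x⃗ w₀
            h       = Agree-trans h₀ (λ v q → sym (override-∈ w x⃗ w₀ v q))
        in ∃⃗-intro {ρ = ρ} x⃗ w₀
             ( lift (from (desc o) (t , t∈T , h))
             , from (≐⃗-⇔ ts z⃗)
                 (trans (sym (⟦⟧ᵗˢ-evals ts p (λ v q → h v (fv q))))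
                   (trans e (evals-fresh-cong x⃗ (λ i → sym (override-∉ w x⃗ w₀ _ (freshVar-∉ x⃗ i))))))))

    SatSO-defines : ∀ {S u} →
      SatSO 𝔄 ρ u (∀⃗ (toList (freshVars x⃗ k)) (pred S z⃗ ⇔² ∃⃗ x⃗ (pred R (vars x⃗) ∧² (ts ≐⃗ z⃗)))) ⇔
      (∀ a⃗ → values 𝔄 ts p T a⃗ ⇔ lookup ρ S a⃗)
    SatSO-defines {S} {u} = mk⇔
      (λ s a⃗ →
        -- The given tuple is realised by some `w`, with which the block over z⃗ is then
        -- instantiated.
        let w , e = evals-fresh-surjective x⃗ a⃗
            o     = override u (toList (freshVars x⃗ k)) w
            o≡    = trans (evals-fresh-cong x⃗ (λ i → override-∈ u (toList (freshVars x⃗ k)) w _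
                            (∈-toList⁺ (∈-tabulate⁺ (freshVar x⃗) i)))) e
        in subst (λ b⃗ → values 𝔄 ts p T b⃗ ⇔ lookup ρ S b⃗) o≡
             (⇔-sym (to (matrix o) (∀⃗-elim (toList (freshVars x⃗ k)) w s))))
      (λ h → ∀⃗-intro (toList (freshVars x⃗ k)) λ w → from (matrix w) (⇔-sym (h _)))
      where
      matrix : ∀ w → SatSO 𝔄 ρ w (pred S z⃗ ⇔² ∃⃗ x⃗ (pred R (vars x⃗) ∧² (ts ≐⃗ z⃗))) ⇔
                     (lookup ρ S (evals 𝔄 w z⃗) ⇔ values 𝔄 ts p T (evals 𝔄 w z⃗))
      matrix w = ⇔²-⇔ {ρ = ρ} {α = pred S z⃗} {β = ∃⃗ x⃗ (pred R (vars x⃗) ∧² (ts ≐⃗ z⃗))}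
                   (⇔-sym Lift-⇔) (SatSO-values w)

-- Unfolding of Sat and η

module _ {τ : Vocabulary} {I : Set} {𝒟 : I → Dependency} where

  -- The body of Sat T φ p contains refl : toFO φ ≡ toFO φ, so toFO φ cannot
  -- be abstracted directly.  Hiding the left-hand side of this equation behind
  -- a data type makes the abstraction well typed.
  data ToFO (φ : TL τ 𝒟) (m : Maybe (FO τ)) : Set where
    hide : toFO φ ≡ m → ToFO φ m

  unhide : ∀ {φ m} → ToFO φ m → toFO φ ≡ m
  unhide (hide e) = e

  hidden : ∀ {φ m} (e : toFO φ ≡ m) → ∃ λ h → unhide {φ} h ≡ e
  hidden e = hide e , refl

  module _ (𝔄 : Structure τ) {X} (T : Team (dom 𝔄) X) where

    Sat-just : ∀ φ {α} .(p : FV φ ⊆ X) .(q : FVᶠ α ⊆ X) → toFO φ ≡ just α →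
               Sat 𝔄 T φ p ≡ Flat {𝒟 = 𝒟} 𝔄 T α q
    Sat-just φ p q e with refl {x = toFO φ}
    ... | r with hidden {φ} r
    ... | h , refl with toFO φ
    Sat-just φ p q refl | _ | h , refl | just _ = refl

    Sat-nothing : ∀ φ .(p : FV φ ⊆ X) → toFO φ ≡ nothing → Sat 𝔄 T φ p ≡ SatClause 𝔄 T φ p
    Sat-nothing φ p e with refl {x = toFO φ}
    ... | r with hidden {φ} r
    ... | h , refl with toFO φ
    Sat-nothing φ p refl | _ | h , refl | nothing = refl

  module _ {Γ} (x⃗ : List Var) (R : length x⃗ ∈ˡ Γ) where

    η-just : ∀ φ {α} → toFO φ ≡ just α → η {τ} {𝒟 = 𝒟} x⃗ φ R ≡ ∀⃗ x⃗ (pred R (vars x⃗) ⇒² embed α)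
    η-just φ e rewrite e = refl

    η-nothing : ∀ φ → toFO φ ≡ nothing → η {τ} {𝒟 = 𝒟} x⃗ φ R ≡ ηClause x⃗ φ R
    η-nothing φ e rewrite e = refl

  -- Induction on formulas

  module _ (𝔄 : Structure τ) where

    private
      A = dom 𝔄

    -- Each `w` satisfying R x⃗ agrees on the free variables of α with a member of T, and each
    -- member of T agrees with such a `w`; the coincidence lemma does the rest.
    Flat-⇔ : ∀ {X Γ} {ρ : PredEnv 𝔄 Γ} x⃗ {R : length x⃗ ∈ˡ Γ} (x⃗⊆X : (_∈ˡ x⃗) ⊆ X) (T : Team A X) α .(p : FVᶠ α ⊆ X) →
             FVᶠ α ⊆ (_∈ˡ x⃗) → Describes 𝔄 x⃗ (lookup ρ R) T → ∀ u →
             Flat {𝒟 = 𝒟} 𝔄 T α p ⇔ SatSO 𝔄 ρ u (∀⃗ x⃗ (pred R (vars x⃗) ⇒² embed α))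
    Flat-⇔ {ρ = ρ} x⃗ x⃗⊆X T α p fv desc u = mk⇔
      (λ (lift s) → ∀⃗-intro 𝔄 x⃗ λ w (lift r) →
        let t , t∈T , h = to (desc w) r in
        to (Tarski-embed 𝔄 {ρ = ρ} α p (λ v q → h v (fv q))) (s t t∈T))
      (λ s → lift λ t t∈T →
        let w , h₀ = totalise 𝔄 x⃗ x⃗⊆X t
            h      = Agree-trans h₀ (λ v q → sym (override-∈ 𝔄 u x⃗ w v q))
        in from (Tarski-embed 𝔄 {ρ = ρ} α p (λ v q → h v (fv q)))
             (∀⃗-elim 𝔄 x⃗ w s (lift (from (desc _) (t , t∈T , h)))))

    mutual
      -- The environment `ρ` is arbitrary because the clauses of `η` bind further predicates before
      -- they reach a subformula.
      Sat-η : ∀ {X Γ} {ρ : PredEnv 𝔄 Γ} φ x⃗ {R : length x⃗ ∈ˡ Γ} (x⃗⊆X : (_∈ˡ x⃗) ⊆ X) (T : Team A X) .(p : FV φ ⊆ X) →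
              FV φ ⊆ (_∈ˡ x⃗) → Describes 𝔄 x⃗ (lookup ρ R) T → ∀ u →
              Sat 𝔄 T φ p ⇔ SatSO 𝔄 ρ u (η {𝒟 = 𝒟} x⃗ φ R)
      Sat-η φ x⃗ x⃗⊆X T p fv desc u = Sat-η-by φ x⃗ x⃗⊆X T p fv desc u (toFO φ) refl

      -- The value of `toFO φ` is a separate argument with an equation, so that the case distinction
      -- leaves `Sat` and `η` intact for the unfolding lemmas.
      Sat-η-by : ∀ {X Γ} {ρ : PredEnv 𝔄 Γ} φ x⃗ {R : length x⃗ ∈ˡ Γ} (x⃗⊆X : (_∈ˡ x⃗) ⊆ X) (T : Team A X) .(p : FV φ ⊆ X) →
                 FV φ ⊆ (_∈ˡ x⃗) → Describes 𝔄 x⃗ (lookup ρ R) T → ∀ u → ∀ m → toFO φ ≡ m →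
                 Sat 𝔄 T φ p ⇔ SatSO 𝔄 ρ u (η {𝒟 = 𝒟} x⃗ φ R)
      Sat-η-by {ρ = ρ} φ x⃗ {R} x⃗⊆X T p fv desc u (just α) e = subst₂ _⇔_
        (sym (Sat-just 𝔄 T φ p (λ q → p (FV-toFO φ e q)) e))
        (sym (cong (SatSO 𝔄 ρ u) (η-just x⃗ R φ e)))
        (Flat-⇔ x⃗ x⃗⊆X T α (λ q → p (FV-toFO φ e q)) (λ q → fv (FV-toFO φ e q)) desc u)
      Sat-η-by {ρ = ρ} φ x⃗ {R} x⃗⊆X T p fv desc u nothing e = subst₂ _⇔_
        (sym (Sat-nothing 𝔄 T φ p e))
        (sym (cong (SatSO 𝔄 ρ u) (η-nothing x⃗ R φ e)))
        (SatClause-ηClause φ x⃗ x⃗⊆X T p fv desc u)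

      SatClause-ηClause :
        ∀ {X Γ} {ρ : PredEnv 𝔄 Γ} φ x⃗ {R : length x⃗ ∈ˡ Γ} (x⃗⊆X : (_∈ˡ x⃗) ⊆ X) (T : Team A X) .(p : FV φ ⊆ X) →
        FV φ ⊆ (_∈ˡ x⃗) → Describes 𝔄 x⃗ (lookup ρ R) T → ∀ u →
        SatClause 𝔄 T φ p ⇔ SatSO 𝔄 ρ u (ηClause {𝒟 = 𝒟} x⃗ φ R)
      SatClause-ηClause (fo α) x⃗ x⃗⊆X T p fv desc u = Flat-⇔ x⃗ x⃗⊆X T α p fv desc u
      SatClause-ηClause {ρ = ρ} (dep i ts) x⃗ {R} x⃗⊆X T p fv desc u = mk⇔
        -- The values of `ts` serve as S; conversely, the defining conjunct makes any S pointwise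
        -- equivalent to them.
        (λ (lift h) → values 𝔄 ts p T ,
          from (defines _) (λ _ → mk⇔ id id) ,
          to (HoldsFor-replaceP 𝔄 (𝒟 i) {ρ = _ ∷ ρ} {S = here refl} (λ _ → mk⇔ id id)) h)
        (λ (Q , def , h) → lift (from (HoldsFor-replaceP 𝔄 (𝒟 i) {ρ = Q ∷ ρ} (to (defines Q) def)) h))
        where
        defines = λ Q → SatSO-defines 𝔄 x⃗ x⃗⊆X ts fv p {ρ = Q ∷ ρ} {R = there R} T desc {S = here refl} {u = u}
      SatClause-ηClause (∼ φ) x⃗ x⃗⊆X T p fv desc u = ¬-cong-⇔ (Sat-η φ x⃗ x⃗⊆X T p fv desc u)
      SatClause-ηClause (φ ∧ᵗ ψ) x⃗ x⃗⊆X T p fv desc u =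
        Sat-η φ x⃗ x⃗⊆X T (λ q → p (inj₁ q)) (fv ∘ inj₁) desc u ×-⇔
        Sat-η ψ x⃗ x⃗⊆X T (λ q → p (inj₂ q)) (fv ∘ inj₂) desc u
      SatClause-ηClause {ρ = ρ} (φ ∨ᵗ ψ) x⃗ {R} x⃗⊆X T p fv desc u = mk⇔
        (λ (S , V , S⊆T , V⊆T , T≡S∪V , satS , satV) →
          let descS = describes-tupleValues 𝔄 x⃗ x⃗⊆X S
              descV = describes-tupleValues 𝔄 x⃗ x⃗⊆X V
          in tupleValues 𝔄 x⃗ x⃗⊆X S , tupleValues 𝔄 x⃗ x⃗⊆X V ,
             from (splits _ _) (λ w → mk⇔
               (λ r → let t , t∈T , h = to (desc w) r in
                 map⊎ (λ s → from (descS w) (t , s , h)) (λ s → from (descV w) (t , s , h)) (to (T≡S∪V t) t∈T))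
               [ (λ s → let t , t∈S , h = to (descS w) s in from (desc w) (t , S⊆T t∈S , h))
               , (λ s → let t , t∈V , h = to (descV w) s in from (desc w) (t , V⊆T t∈V , h)) ]′) ,
             to (Sat-η φ x⃗ x⃗⊆X S (λ q → p (inj₁ q)) (fv ∘ inj₁) descS u) satS ,
             to (Sat-η ψ x⃗ x⃗⊆X V (λ q → p (inj₂ q)) (fv ∘ inj₂) descV u) satV)
        (λ (Q , Q′ , split , satQ , satQ′) →
          let e     = to (splits Q Q′) split
              S     = restrict 𝔄 x⃗ x⃗⊆X Q T
              V     = restrict 𝔄 x⃗ x⃗⊆X Q′ T
              descS = describes-restrict 𝔄 x⃗ x⃗⊆X Q {T} (λ w q → to (desc w) (from (e w) (inj₁ q)))
              descV = describes-restrict 𝔄 x⃗ x⃗⊆X Q′ {T} (λ w q → to (desc w) (from (e w) (inj₂ q)))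
          in S , V , proj₁ , proj₁ ,
             (λ t → mk⇔
               -- The tuple of t satisfies R, hence one of the two parts, and this already decides
               -- membership of t in S or V.
               (λ t∈T → let w , h = totalise 𝔄 x⃗ x⃗⊆X t in
                 map⊎ (λ q → t∈T , w , h , q) (λ q → t∈T , w , h , q)
                      (to (e w) (from (desc w) (t , t∈T , h))))
               [ proj₁ , proj₁ ]′) ,
             from (Sat-η φ x⃗ x⃗⊆X S (λ q → p (inj₁ q)) (fv ∘ inj₁) descS u) satQ ,
             from (Sat-η ψ x⃗ x⃗⊆X V (λ q → p (inj₂ q)) (fv ∘ inj₂) descV u) satQ′)
        where
        -- The inner quantifier binds V, so V heads the environment, S comes second, and R is
        -- shifted twice.
        splits = λ Q Q′ → SatSO-splits 𝔄 x⃗ {ρ = Q′ ∷ Q ∷ ρ} {u = u}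
                            {R = there (there R)} {S = there (here refl)} {V = here refl}
      SatClause-ηClause {ρ = ρ} (∃ᵗ y φ) x⃗ {R} x⃗⊆X T p fv desc u = mk⇔
        (λ (f , sat) →
          let Q     = tupleValues 𝔄 (x⃗ ﹔ y) (﹔⊆∪ x⃗⊆X) (T ⟨ y ≔ f ⟩)
              desc′ = describes-tupleValues 𝔄 (x⃗ ﹔ y) (﹔⊆∪ x⃗⊆X) (T ⟨ y ≔ f ⟩)
          in Q , from (linked Q) (describes⇒linked Q f desc′) , to (ih f Q desc′) sat)
        (λ (Q , link , sat) →
          let l = to (linked Q) link
              f = supplement Q l
          in f , from (ih f Q (describes-supplement Q l)) sat)
        where
        open Quantifier 𝔄 x⃗ x⃗⊆X y (lookup ρ R) T desc
        linked = λ Q → SatSO-linked 𝔄 {ρ = Q ∷ ρ} {u = u} y x⃗ {R = there R} {S = here refl}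
        ih = λ f Q desc′ → Sat-η {ρ = Q ∷ ρ} φ (x⃗ ﹔ y) {here refl} (﹔⊆∪ x⃗⊆X) (T ⟨ y ≔ f ⟩)
                             (∖⊆⇒⊆∪ y p) (∖⊆⇒⊆﹔ fv) desc′ u
      SatClause-ηClause {ρ = ρ} (∀ᵗ y φ) x⃗ {R} x⃗⊆X T p fv desc u = mk⇔
        (λ sat →
          let Q     = tupleValues 𝔄 (x⃗ ﹔ y) (﹔⊆∪ x⃗⊆X) (T ⟨ y ≔ f ⟩)
              desc′ = describes-tupleValues 𝔄 (x⃗ ﹔ y) (﹔⊆∪ x⃗⊆X) (T ⟨ y ≔ f ⟩)
          in Q , from (linked Q) (describes⇒linked Q f desc′) , to (ih Q desc′) sat ,
             from (covers Q) (describes-full⇒covers Q (point 𝔄) desc′))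
        -- Together `link` and `cover` force Q to describe the team in which y ranges over the whole
        -- domain.
        (λ (Q , link , sat , cover) →
          from (ih Q (describes-full Q (to (linked Q) link) (point 𝔄) (to (covers Q) cover))) sat)
        where
        open Quantifier 𝔄 x⃗ x⃗⊆X y (lookup ρ R) T desc
        f = full T (point 𝔄)
        linked = λ Q → SatSO-linked 𝔄 {ρ = Q ∷ ρ} {u = u} y x⃗ {R = there R} {S = here refl}
        covers = λ Q → SatSO-covers 𝔄 {ρ = Q ∷ ρ} {u = u} y x⃗ {R = there R} {S = here refl}
        ih = λ Q desc′ → Sat-η {ρ = Q ∷ ρ} φ (x⃗ ﹔ y) {here refl} (﹔⊆∪ x⃗⊆X) (T ⟨ y ≔ f ⟩)
                           (∖⊆⇒⊆∪ y p) (∖⊆⇒⊆﹔ fv) desc′ u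

theorem3p1 : {τ : Vocabulary} {I : Set} {𝒟 : I → Dependency}
    (φ : TL τ 𝒟) (x⃗ : List Var) (fv : FV φ ⊆ (_∈ˡ x⃗))
    (𝔄 : Structure τ) → FiniteStructure 𝔄 →
    (Y : Pred Var 0ℓ) (x⃗⊆Y : (_∈ˡ x⃗) ⊆ Y)
    (T : Team (dom 𝔄) Y) → FiniteTeam T →
    Sat 𝔄 T φ (λ q → x⃗⊆Y (fv q)) ⇔ Models 𝔄 (tupleValues 𝔄 x⃗ x⃗⊆Y T ∷ []) (η x⃗ φ (here refl))
-- `Models` ranges over all first-order assignments, and the equivalence holds at each of them; the
-- converse instantiates it at the constant assignment with value `point`.
theorem3p1 φ x⃗ fv 𝔄 _ Y x⃗⊆Y T _ = mk⇔ (λ sat u → to (equiv u) sat) (λ m → from (equiv _) (m (λ _ → point 𝔄)))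
  where
  equiv = Sat-η 𝔄 φ x⃗ x⃗⊆Y T (λ q → x⃗⊆Y (fv q)) fv (describes-tupleValues 𝔄 x⃗ x⃗⊆Y T)
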